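{- Let $r,c>1$ be integers and let $A$ be a binary, equireplicate $r\times c$ array on $v$ symbols, with replication number $e$. (1) If $2c-v = \frac{c(e-1)}{r-1}$, then any two distinct rows of $A$ have exactly $\frac{c(e-1)}{r-1}$ common symbols; in particular $A$ has constant row-row intersection size (property RR). (2) If $2r-v = \frac{r(e-1)}{c-1}$, then any two distinct columns of $A$ have exactly $\frac{r(e-1)}{c-1}$ common symbols; in particular $A$ has constant column-column intersection size (property CC).
   Context: An array is binary if no symbol occurs more than once in any row or in any column; it is equireplicate with replication number $e$ if each of the $v$ symbols occurs exactly $e$ times in the array (so $ev=rc$). Rows and columns are identified with the sets of symbols they contain. Property RR: any two distinct rows have the same number $\lambda_{rr}$ of common symbols. Property CC: any two distinct columns have the same number $\lambda_{cc}$ of common symbols. -}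

module Defs where

open import Data.Nat.Base using (ℕ; _∸_; _<_; >-nonZero)
open import Data.Nat.Properties using (m<n⇒0<n∸m)
open import Data.Integer.Base as ℤ using (ℤ; +_; 1ℤ)
open import Data.Rational.Base using (ℚ; _/_)
open import Data.Fin.Base using (Fin)
open import Data.Fin.Properties using (_≟_; any?)
open import Data.Fin.Subset using (Subset; _∩_; ∣_∣)
open import Data.List.Base using (length; filter; cartesianProduct; allFin)
open import Data.Product.Base using (_×_; _,_; ∃-syntax)
open import Data.Vec.Base using (tabulate)
open import Function.Definitions using (Injective)
open import Relation.Binary.PropositionalEquality using (_≡_; _≢_)
open import Relation.Nullary.Decidable using (⌊_⌋)

-- An r × c array whose entries are drawn from a set of v symbols.
Array : ℕ → ℕ → ℕ → Set
Array r c v = Fin r → Fin c → Fin v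

module _ {r c v : ℕ} (A : Array r c v) where

  Binary : Set
  Binary = (∀ i → Injective _≡_ _≡_ (λ j → A i j))
         × (∀ j → Injective _≡_ _≡_ (λ i → A i j))

  occurrences : Fin v → ℕ
  occurrences s =
    length (filter (λ (i , j) → A i j ≟ s) (cartesianProduct (allFin r) (allFin c)))

  Equireplicate : ℕ → Set
  Equireplicate e = ∀ s → occurrences s ≡ e

  rowSymbols : Fin r → Subset v
  rowSymbols i = tabulate (λ s → ⌊ any? (λ j → A i j ≟ s) ⌋)

  colSymbols : Fin c → Subset v
  colSymbols j = tabulate (λ s → ⌊ any? (λ i → A i j ≟ s) ⌋)

  -- Rows (columns) are distinct when their indices are; as sets of symbols
  -- they may coincide.
  PropertyRR : Set
  PropertyRR = ∃[ λrr ] (∀ i i′ → i ≢ i′ → ∣ rowSymbols i ∩ rowSymbols i′ ∣ ≡ λrr)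

  PropertyCC : Set
  PropertyCC = ∃[ λcc ] (∀ j j′ → j ≢ j′ → ∣ colSymbols j ∩ colSymbols j′ ∣ ≡ λcc)

fromℤ : ℤ → ℚ
fromℤ z = z / 1

-- The rational number m (e - 1) / (n - 1).  The numerator is formed in ℤ, and
-- n ∸ 1 does not truncate since 1 < n.
intersectionRatio : (m e n : ℕ) → 1 < n → ℚ
intersectionRatio m e n 1<n =
  _/_ (+ m ℤ.* (+ e ℤ.- 1ℤ)) (n ∸ 1) {{>-nonZero (m<n⇒0<n∸m 1<n)}}

{-# OPTIONS --safe #-}

-- Row i has c symbols, each lying in e rows, so the intersection sizes
-- ∣ Rᵢ ∩ Rᵢ′ ∣ with i′ ≠ i add up to c(e − 1).  Inclusion–exclusion bounds each
-- of these r − 1 numbers below by 2c − v.  When 2c − v is also their average,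
-- all of them attain the bound.  Part (2) is part (1) for the transposed array.

module Submission where

open import Defs
open import Data.Nat.Base using (ℕ; _<_)
open import Data.Integer.Base using (+_; _-_; _*_)
open import Data.Fin.Subset using (_∩_; ∣_∣)
open import Data.Product.Base using (_×_)
open import Relation.Binary.PropositionalEquality using (_≡_; _≢_)

import Algebra.Properties.Semiring.Sum
open import Data.Bool.Base using (Bool; true; false; if_then_else_; _∧_)
open import Data.Bool.Properties using (∧-idem)
open import Data.Fin.Base using (Fin; zero; suc; punchOut)
open import Data.Fin.Properties using (_≟_; any?; suc-injective)
open import Data.Integer.Base using (1ℤ) renaming (_+_ to _+ᶻ_)
open import Data.Integer.Properties using (+-injective; pos-+; pos-*)
  renaming (*-identityʳ to *ᶻ-identityʳ)
open import Data.Integer.Tactic.RingSolver using (solve-∀)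
open import Data.List.Base as List using (length; filter; cartesianProduct)
open import Data.List.Properties using (length-++; filter-++; map-tabulate)
open import Data.Nat.Base using (zero; suc; _+_; _∸_; _≤_; z≤n; NonZero; >-nonZero)
  renaming (_*_ to _*ᴺ_)
open import Data.Nat.Properties
  using (≤-refl; ≤-trans; ≤-reflexive; +-mono-≤; +-monoˡ-≤; +-monoʳ-≤; +-cancelˡ-≤; +-cancelʳ-≤;
         ≤-antisym; m+n∸n≡m; *-identityʳ; +-identityʳ; +-*-semiring; m<n⇒0<n∸m)
open import Data.Product.Base using (_,_)
open import Data.Rational.Base using (_/_)
open import Data.Rational.Properties using (/-injective-≃)
open import Data.Rational.Unnormalised.Base using (mkℚᵘ; *≡*)
open import Data.Vec.Base using (tabulate)
open import Data.Vec.Functional using (Vector; removeAt)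
open import Data.Vec.Functional.Properties using (removeAt-punchOut)
open import Function.Base using (_∘_; id)
open import Function.Definitions using (Injective)
open import Level using (Level)
open import Relation.Binary.PropositionalEquality
  using (refl; sym; trans; cong; cong₂; subst₂; module ≡-Reasoning)
open import Relation.Nullary.Decidable using (yes; no; ⌊_⌋)
open import Relation.Nullary.Negation using (contradiction)
open import Relation.Unary using (Pred; Decidable)

open Algebra.Properties.Semiring.Sum +-*-semiring
  using (sum; sum-syntax; sum-cong-≗; sum-remove; ∑-comm; ∑-distrib-+; *-distribˡ-sum; *-distribʳ-sum)

private
  variable
    a p : Level
    n : ℕ

-- Finite sums of natural numbers.

sum-const : ∀ n k → ∑[ i < n ] k ≡ n *ᴺ k
sum-const zero    k = refl
sum-const (suc n) k = cong (λ m → k + m) (sum-const n k)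

sum-mono-≤ : (f g : Vector ℕ n) → (∀ i → f i ≤ g i) → sum f ≤ sum g
sum-mono-≤ {zero}  f g f≤g = z≤n
sum-mono-≤ {suc n} f g f≤g =
  +-mono-≤ (f≤g zero) (sum-mono-≤ (f ∘ suc) (g ∘ suc) (f≤g ∘ suc))

-- The differences `g i - f i` are nonnegative with total at most 0, so each vanishes. To stay in ℕ,
-- the proof bounds the head or the tail by monotonicity and cancels it.
sum-mono-≤-rigid : (f g : Vector ℕ n) → (∀ i → f i ≤ g i) → sum g ≤ sum f → ∀ i → f i ≡ g i
sum-mono-≤-rigid f g f≤g Σg≤Σf zero = ≤-antisym (f≤g zero)
  (+-cancelʳ-≤ (sum (f ∘ suc)) _ _
    (≤-trans (+-monoʳ-≤ (g zero) (sum-mono-≤ (f ∘ suc) (g ∘ suc) (f≤g ∘ suc))) Σg≤Σf))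
sum-mono-≤-rigid f g f≤g Σg≤Σf (suc i) =
  sum-mono-≤-rigid (f ∘ suc) (g ∘ suc) (f≤g ∘ suc)
    (+-cancelˡ-≤ (f zero) _ _ (≤-trans (+-monoˡ-≤ (sum (g ∘ suc)) (f≤g zero)) Σg≤Σf)) i

-- Cardinalities as sums of 0/1 indicators.

⟦_⟧ : Bool → ℕ
⟦ b ⟧ = if b then 1 else 0

⟦∧⟧ : ∀ x y → ⟦ x ∧ y ⟧ ≡ ⟦ x ⟧ *ᴺ ⟦ y ⟧
⟦∧⟧ true  y = sym (+-identityʳ ⟦ y ⟧)
⟦∧⟧ false y = refl

-- Slack occurs only when both are false, that is, at a symbol lying in neither row.
⟦⟧-inclusion-exclusion : ∀ x y → ⟦ x ⟧ + ⟦ y ⟧ ≤ ⟦ x ∧ y ⟧ + 1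
⟦⟧-inclusion-exclusion true  true  = ≤-refl
⟦⟧-inclusion-exclusion true  false = ≤-refl
⟦⟧-inclusion-exclusion false true  = ≤-refl
⟦⟧-inclusion-exclusion false false = z≤n

-- Uniqueness leaves at most one nonzero summand, so testing for a witness and counting witnesses
-- agree. This turns set membership into a sum that can be exchanged with others.
⟦any?⟧ : {P : Pred (Fin n) p} (P? : Decidable P) → (∀ {i j} → P i → P j → i ≡ j) →
         ⟦ ⌊ any? P? ⌋ ⟧ ≡ ∑[ i < n ] ⟦ ⌊ P? i ⌋ ⟧
⟦any?⟧ {n = zero}  P? unique = refl
⟦any?⟧ {n = suc n} P? unique
  -- The induction hypothesis is abstracted too, so that its left side reduces along with the match
  -- on `any? (P? ∘ suc)`.
  with P? zero | any? (P? ∘ suc) | ⟦any?⟧ (P? ∘ suc) (λ Pi Pj → suc-injective (unique Pi Pj))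
... | yes P₀ | yes (j , Pj) | _  = contradiction (unique P₀ Pj) λ ()
... | yes _  | no _         | eq = cong suc eq
... | no _   | yes _        | eq = eq
... | no _   | no _         | eq = eq

∑⟦≟⟧≡1 : (a : Fin n) → ∑[ s < n ] ⟦ ⌊ a ≟ s ⌋ ⟧ ≡ 1
∑⟦≟⟧≡1 a with any? (a ≟_) | ⟦any?⟧ (a ≟_) (λ p q → trans (sym p) q)
... | yes _ | eq = sym eq
... | no ¬∃ | _  = contradiction (a , refl) ¬∃

∣tabulate-∩∣ : (f g : Fin n → Bool) → ∣ tabulate f ∩ tabulate g ∣ ≡ ∑[ s < n ] ⟦ f s ∧ g s ⟧
∣tabulate-∩∣ {n = zero}  f g = refl
∣tabulate-∩∣ {n = suc n} f g with f zero ∧ g zero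
... | true  = cong suc (∣tabulate-∩∣ (f ∘ suc) (g ∘ suc))
... | false = ∣tabulate-∩∣ (f ∘ suc) (g ∘ suc)

length-filter-tabulate :
  {A : Set a} {P : Pred A p} (P? : Decidable P) (f : Fin n → A) →
  length (filter P? (List.tabulate f)) ≡ ∑[ i < n ] ⟦ ⌊ P? (f i) ⌋ ⟧
length-filter-tabulate {n = zero}  P? f = refl
length-filter-tabulate {n = suc n} P? f with P? (f zero)
... | yes _ = cong suc (length-filter-tabulate P? (f ∘ suc))
... | no _  = length-filter-tabulate P? (f ∘ suc)

length-filter-cartesianProduct :
  ∀ {m} {A B : Set a} {P : Pred (A × B) p} (P? : Decidable P) (f : Fin m → A) (g : Fin n → B) →
  length (filter P? (cartesianProduct (List.tabulate f) (List.tabulate g))) ≡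
  ∑[ i < m ] ∑[ j < n ] ⟦ ⌊ P? (f i , g j) ⌋ ⟧
length-filter-cartesianProduct {m = zero}  P? f g = refl
length-filter-cartesianProduct {m = suc m} P? f g = begin
  length (filter P? (row List.++ rest))                  ≡⟨ cong length (filter-++ P? row rest) ⟩
  length (filter P? row List.++ filter P? rest)          ≡⟨ length-++ (filter P? row) ⟩
  length (filter P? row) + length (filter P? rest)       ≡⟨ cong₂ _+_ head-row (length-filter-cartesianProduct P? (f ∘ suc) g) ⟩
  _                                                      ∎
  where
  open ≡-Reasoning
  row  = List.map (f zero ,_) (List.tabulate g)
  rest = cartesianProduct (List.tabulate (f ∘ suc)) (List.tabulate g)
  head-row : length (filter P? row) ≡ ∑[ j < _ ] ⟦ ⌊ P? (f zero , g j) ⌋ ⟧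
  head-row = trans (cong (length ∘ filter P?) (map-tabulate g (f zero ,_)))
                   (length-filter-tabulate P? (λ j → f zero , g j))

fromℤ≡/⇒*≡ : ∀ x y d .{{_ : NonZero d}} → fromℤ x ≡ y / d → x * + d ≡ y
-- `mkℚᵘ` stores the denominator minus one: `0` and `d` stand for 1 and `suc d`.
fromℤ≡/⇒*≡ x y (suc d) eq with /-injective-≃ (mkℚᵘ x 0) (mkℚᵘ y d) eq
... | *≡* eq′ = trans eq′ (*ᶻ-identityʳ y)

-- Double counting of symbols in rows.

module _ {r c v : ℕ} (A : Array r c v) where

  transpose : Array c r v
  transpose j i = A i j

  occurrences-∑ : ∀ s → occurrences A s ≡ ∑[ i < r ] ∑[ j < c ] ⟦ ⌊ A i j ≟ s ⌋ ⟧
  -- `allFin` is by definition `tabulate id`, hence the two `id`s.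
  occurrences-∑ s = length-filter-cartesianProduct (λ (i , j) → A i j ≟ s) id id

  -- For `transpose A` this is the column half of `Binary`, so one row argument serves both parts.
  RowsInjective : Set
  RowsInjective = ∀ i → Injective _≡_ _≡_ (A i)

  inRow : Fin r → Fin v → Bool
  inRow i s = ⌊ any? (λ j → A i j ≟ s) ⌋

  ∣row∩row∣ : Fin r → Fin r → ℕ
  ∣row∩row∣ i i′ = ∣ rowSymbols A i ∩ rowSymbols A i′ ∣

  ∣row∩row∣-∑ : ∀ i i′ → ∣row∩row∣ i i′ ≡ ∑[ s < v ] ⟦ inRow i s ∧ inRow i′ s ⟧
  ∣row∩row∣-∑ i i′ = ∣tabulate-∩∣ (inRow i) (inRow i′)

transpose-occurrences : ∀ {r c v} (A : Array r c v) s →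
                        occurrences (transpose A) s ≡ occurrences A s
transpose-occurrences {r} {c} A s = begin
  occurrences (transpose A) s                   ≡⟨ occurrences-∑ (transpose A) s ⟩
  ∑[ j < c ] ∑[ i < r ] ⟦ ⌊ A i j ≟ s ⌋ ⟧  ≡⟨ ∑-comm (λ j i → ⟦ ⌊ A i j ≟ s ⌋ ⟧) ⟩
  ∑[ i < r ] ∑[ j < c ] ⟦ ⌊ A i j ≟ s ⌋ ⟧  ≡⟨ occurrences-∑ A s ⟨
  occurrences A s                               ∎
  where open ≡-Reasoning

module _ {r c v : ℕ} (A : Array r c v) (inj : RowsInjective A) where
  open ≡-Reasoning

  ⟦inRow⟧ : ∀ i s → ⟦ inRow A i s ⟧ ≡ ∑[ j < c ] ⟦ ⌊ A i j ≟ s ⌋ ⟧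
  ⟦inRow⟧ i s = ⟦any?⟧ (λ j → A i j ≟ s) (λ p q → inj i (trans p (sym q)))

  -- Exchanging the sums counts by cells: each of the `c` cells of the row carries exactly one
  -- symbol.
  ∑-inRow : ∀ i → ∑[ s < v ] ⟦ inRow A i s ⟧ ≡ c
  ∑-inRow i = begin
    ∑[ s < v ] ⟦ inRow A i s ⟧                 ≡⟨ sum-cong-≗ (⟦inRow⟧ i) ⟩
    ∑[ s < v ] ∑[ j < c ] ⟦ ⌊ A i j ≟ s ⌋ ⟧  ≡⟨ ∑-comm (λ s j → ⟦ ⌊ A i j ≟ s ⌋ ⟧) ⟩
    ∑[ j < c ] ∑[ s < v ] ⟦ ⌊ A i j ≟ s ⌋ ⟧  ≡⟨ sum-cong-≗ (λ j → ∑⟦≟⟧≡1 (A i j)) ⟩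
    ∑[ j < c ] 1                               ≡⟨ sum-const c 1 ⟩
    c *ᴺ 1                                     ≡⟨ *-identityʳ c ⟩
    c                                          ∎

  -- A row holds `s` in at most one cell, so counting rows that contain `s` counts its cells.
  ∑-rows-containing : ∀ s → ∑[ i < r ] ⟦ inRow A i s ⟧ ≡ occurrences A s
  ∑-rows-containing s =
    trans (sum-cong-≗ (λ i → ⟦inRow⟧ i s)) (sym (occurrences-∑ A s))

  ∣row∩row∣-self : ∀ i → ∣row∩row∣ A i i ≡ c
  ∣row∩row∣-self i = begin
    ∣row∩row∣ A i i                             ≡⟨ ∣row∩row∣-∑ A i i ⟩
    ∑[ s < v ] ⟦ inRow A i s ∧ inRow A i s ⟧   ≡⟨ sum-cong-≗ (λ s → cong ⟦_⟧ (∧-idem (inRow A i s))) ⟩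
    ∑[ s < v ] ⟦ inRow A i s ⟧                 ≡⟨ ∑-inRow i ⟩
    c                                          ∎

  -- The union of two rows has at most `v` symbols. The additive form avoids truncated subtraction
  -- in 2c - v.
  ∣row∩row∣-lower : ∀ i i′ → c + c ≤ ∣row∩row∣ A i i′ + v
  ∣row∩row∣-lower i i′ = subst₂ _≤_ lhs rhs
    (sum-mono-≤ _ _ (λ s → ⟦⟧-inclusion-exclusion (inRow A i s) (inRow A i′ s)))
    where
    lhs : ∑[ s < v ] (⟦ inRow A i s ⟧ + ⟦ inRow A i′ s ⟧) ≡ c + c
    lhs = trans (∑-distrib-+ (λ s → ⟦ inRow A i s ⟧) _) (cong₂ _+_ (∑-inRow i) (∑-inRow i′))
    rhs : ∑[ s < v ] (⟦ inRow A i s ∧ inRow A i′ s ⟧ + 1) ≡ ∣row∩row∣ A i i′ + v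
    rhs = trans (∑-distrib-+ (λ s → ⟦ inRow A i s ∧ inRow A i′ s ⟧) (λ _ → 1))
      (cong₂ _+_ (sym (∣row∩row∣-∑ A i i′)) (trans (sum-const v 1) (*-identityʳ v)))

  -- Both sides count pairs of a symbol of row `i` and a row containing it. The term `i′ = i` is
  -- included, hence `c *ᴺ e` and not yet c(e - 1).
  ∑-∣row∩row∣ : ∀ {e} → Equireplicate A e → ∀ i → ∑[ i′ < r ] ∣row∩row∣ A i i′ ≡ c *ᴺ e
  ∑-∣row∩row∣ {e} equi i = begin
    ∑[ i′ < r ] ∣row∩row∣ A i i′
      ≡⟨ sum-cong-≗ (λ i′ → trans (∣row∩row∣-∑ A i i′)
           (sum-cong-≗ (λ s → ⟦∧⟧ (inRow A i s) (inRow A i′ s)))) ⟩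
    ∑[ i′ < r ] ∑[ s < v ] (⟦ inRow A i s ⟧ *ᴺ ⟦ inRow A i′ s ⟧)
      ≡⟨ ∑-comm (λ i′ s → ⟦ inRow A i s ⟧ *ᴺ ⟦ inRow A i′ s ⟧) ⟩
    ∑[ s < v ] ∑[ i′ < r ] (⟦ inRow A i s ⟧ *ᴺ ⟦ inRow A i′ s ⟧)
      ≡⟨ sum-cong-≗ (λ s → *-distribˡ-sum ⟦ inRow A i s ⟧ (λ i′ → ⟦ inRow A i′ s ⟧)) ⟨
    ∑[ s < v ] (⟦ inRow A i s ⟧ *ᴺ ∑[ i′ < r ] ⟦ inRow A i′ s ⟧)
      ≡⟨ sum-cong-≗ (λ s → cong (⟦ inRow A i s ⟧ *ᴺ_) (trans (∑-rows-containing s) (equi s))) ⟩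
    ∑[ s < v ] (⟦ inRow A i s ⟧ *ᴺ e)
      ≡⟨ *-distribʳ-sum e (λ s → ⟦ inRow A i s ⟧) ⟨
    (∑[ s < v ] ⟦ inRow A i s ⟧) *ᴺ e
      ≡⟨ cong (_*ᴺ e) (∑-inRow i) ⟩
    c *ᴺ e ∎

-- The equality case and its transfer to columns.

-- With n = r - 1 and `g` the total of the off-diagonal intersection sizes, `total` gives g = c(e -
-- 1), which `tight` turns into n(2c - v). The computation runs in ℤ, where differences are exact.
excess-identity : ∀ c v e n g →
  (+ 2 * + c - + v) * + n ≡ + c * (+ e - 1ℤ) → c + g ≡ c *ᴺ e → g + n *ᴺ v ≡ n *ᴺ (c + c)
excess-identity c v e n g tight total = +-injective (begin
  + (g + n *ᴺ v)
    ≡⟨ trans (pos-+ g _) (cong (+ g +ᶻ_) (pos-* n v)) ⟩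
  + g +ᶻ + n * + v
    ≡⟨ split (+ c) (+ g) (+ n * + v) ⟩
  (+ c +ᶻ + g) - + c +ᶻ + n * + v
    ≡⟨ cong (λ t → t - + c +ᶻ + n * + v) (trans (sym (pos-+ c g)) (trans (cong +_ total) (pos-* c e))) ⟩
  + c * + e - + c +ᶻ + n * + v
    ≡⟨ factor (+ c) (+ e) (+ n * + v) ⟩
  + c * (+ e - 1ℤ) +ᶻ + n * + v
    ≡⟨ cong (_+ᶻ + n * + v) tight ⟨
  (+ 2 * + c - + v) * + n +ᶻ + n * + v
    ≡⟨ collect (+ c) (+ v) (+ n) ⟩
  + n * (+ c +ᶻ + c)
    ≡⟨ trans (pos-* n (c + c)) (cong (+ n *_) (pos-+ c c)) ⟨
  + (n *ᴺ (c + c)) ∎)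
  where
  open ≡-Reasoning
  split : ∀ C G X → G +ᶻ X ≡ (C +ᶻ G) - C +ᶻ X
  split = solve-∀
  factor : ∀ C E X → C * E - C +ᶻ X ≡ C * (E - 1ℤ) +ᶻ X
  factor = solve-∀
  collect : ∀ C V N → (+ 2 * C - V) * N +ᶻ N * V ≡ N * (C +ᶻ C)
  collect = solve-∀

∣row∩row∣-tight :
  ∀ {n c v e} (A : Array (suc n) c v) → RowsInjective A → Equireplicate A e →
  (+ 2 * + c - + v) * + n ≡ + c * (+ e - 1ℤ) →
  ∀ i i′ → i ≢ i′ → ∣row∩row∣ A i i′ + v ≡ c + c
∣row∩row∣-tight {n} {c} {v} {e} A inj equi tight i i′ i≢i′ = begin
  ∣row∩row∣ A i i′ + v                ≡⟨ cong (_+ v) (removeAt-punchOut (∣row∩row∣ A i) i≢i′) ⟨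
  -- `punchOut i≢i′` is the position of `i′` once row `i` is removed. There the constant `c + c` is
  -- a lower bound whose total is attained, so rigidity applies.
  others (punchOut i≢i′) + v          ≡⟨ sum-mono-≤-rigid _ _ (λ k → ∣row∩row∣-lower A inj i _)
                                           (≤-reflexive sums-agree) (punchOut i≢i′) ⟨
  c + c                               ∎
  where
  open ≡-Reasoning
  others : Vector ℕ n
  others = removeAt (∣row∩row∣ A i) i

  total : c + sum others ≡ c *ᴺ e
  total = begin
    c + sum others                 ≡⟨ cong (_+ sum others) (∣row∩row∣-self A inj i) ⟨
    ∣row∩row∣ A i i + sum others   ≡⟨ sum-remove (∣row∩row∣ A i) ⟨
    sum (∣row∩row∣ A i)            ≡⟨ ∑-∣row∩row∣ A inj equi i ⟩
    c *ᴺ e                         ∎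

  sums-agree : ∑[ k < n ] (others k + v) ≡ ∑[ k < n ] (c + c)
  sums-agree = begin
    ∑[ k < n ] (others k + v)      ≡⟨ ∑-distrib-+ others (λ _ → v) ⟩
    sum others + ∑[ k < n ] v      ≡⟨ cong (λ m → sum others + m) (sum-const n v) ⟩
    sum others + n *ᴺ v            ≡⟨ excess-identity c v e n (sum others) tight total ⟩
    n *ᴺ (c + c)                   ≡⟨ sum-const n (c + c) ⟨
    ∑[ k < n ] (c + c)             ∎

rows-intersect-constantly :
  ∀ (r c v e : ℕ) (1<r : 1 < r) (A : Array r c v) → RowsInjective A → Equireplicate A e →
  fromℤ (+ 2 * + c - + v) ≡ intersectionRatio c e r 1<r →
  (∀ i i′ → i ≢ i′ →
    fromℤ (+ ∣ rowSymbols A i ∩ rowSymbols A i′ ∣) ≡ intersectionRatio c e r 1<r)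
  × PropertyRR A
rows-intersect-constantly (suc n) c v e 1<r A inj equi ratio =
  (λ i i′ i≢i′ → trans (cong fromℤ (integral _ (size i i′ i≢i′))) ratio) ,
  -- Truncation is harmless: `size` exhibits `c + c` as an intersection size plus `v`.
  (c + c ∸ v , λ i i′ i≢i′ →
    trans (sym (m+n∸n≡m _ v)) (cong (_∸ v) (size i i′ i≢i′)))
  where
  size = ∣row∩row∣-tight {e = e} A inj equi
    -- The denominator `suc n ∸ 1` computes to `n`, so clearing it gives the integer equation
    -- required.
    (fromℤ≡/⇒*≡ (+ 2 * + c - + v) _ n {{>-nonZero (m<n⇒0<n∸m 1<r)}} ratio)

  cancel : ∀ M V → M ≡ (M +ᶻ V) - V
  cancel = solve-∀
  double : ∀ C V → (C +ᶻ C) - V ≡ + 2 * C - V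
  double = solve-∀

  integral : ∀ m → m + v ≡ c + c → + m ≡ + 2 * + c - + v
  integral m eq = begin
    + m                    ≡⟨ cancel (+ m) (+ v) ⟩
    (+ m +ᶻ + v) - + v     ≡⟨ cong (_- + v) (trans (sym (pos-+ m v)) (trans (cong +_ eq) (pos-+ c c))) ⟩
    (+ c +ᶻ + c) - + v     ≡⟨ double (+ c) (+ v) ⟩
    + 2 * + c - + v        ∎
    where open ≡-Reasoning

proposition3p2 : (r c v e : ℕ) (1<r : 1 < r) (1<c : 1 < c) (A : Array r c v) →
    Binary A → Equireplicate A e →
    (fromℤ (+ 2 * + c - + v) ≡ intersectionRatio c e r 1<r →
    (∀ i i′ → i ≢ i′ →
    fromℤ (+ ∣ rowSymbols A i ∩ rowSymbols A i′ ∣) ≡ intersectionRatio c e r 1<r)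
    × PropertyRR A)
    ×
    (fromℤ (+ 2 * + r - + v) ≡ intersectionRatio r e c 1<c →
    (∀ j j′ → j ≢ j′ →
    fromℤ (+ ∣ colSymbols A j ∩ colSymbols A j′ ∣) ≡ intersectionRatio r e c 1<c)
    × PropertyCC A)
proposition3p2 r c v e 1<r 1<c A (rowsInj , colsInj) equi =
  rows-intersect-constantly r c v e 1<r A rowsInj equi ,
  -- `rowSymbols (transpose A)` and `colSymbols A` unfold to the same term, so the row statement for
  -- the transpose is the column statement for `A`.
  rows-intersect-constantly c r v e 1<c (transpose A) colsInj
    (λ s → trans (transpose-occurrences A s) (equi s))
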